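{- For every integer $k$, every finite set of at least $\mathrm{ES}(k)$ points in the plane (not necessarily in general position) contains $k$ points in convex position.
   Context: A finite set $P$ of points in the plane is in general position if no three points of $P$ are collinear. $P$ is in convex position if every point of $P$ is on the boundary of its convex hull $\mathrm{conv}(P)$ (this is the non-strict notion: for example, any finite set of collinear points is in convex position). For an integer $k$, $\mathrm{ES}(k)$ denotes the minimum nonnegative integer such that every finite set of at least $\mathrm{ES}(k)$ points in general position in the plane contains $k$ points in convex position (it exists by the Erdős–Szekeres Theorem). Containing $k$ points in convex position means having a subset of at least $k$ points that is in convex position. -}

module Defs where

open import Algebra.Bundles using (CommutativeRing)
import Algebra.Definitions.RawMonoid as RawMonoidDefinitions
open import Data.Fin using (Fin)
import Data.Fin.Subset as Subset
open import Data.Integer using (ℤ; +_)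
import Data.Integer as ℤ
open import Data.Nat using (ℕ)
import Data.Nat as ℕ
open import Data.Product using (_×_; _,_; proj₁; proj₂; ∃; ∃-syntax; Σ-syntax)
open import Data.Product.Relation.Binary.Pointwise.NonDependent using (Pointwise)
open import Data.Vec.Functional using (Vector)
open import Function.Definitions using (Injective)
open import Level using (0ℓ) renaming (suc to lsuc)
open import Relation.Binary.Core using (Rel)
import Relation.Binary.Construct.StrictToNonStrict as StrictToNonStrict
open import Relation.Binary.PropositionalEquality using (_≡_; _≢_)
open import Relation.Binary.Structures using (IsStrictTotalOrder)
open import Relation.Nullary using (¬_)
open import Relation.Unary using (Pred; _∈_; _∉_; _⊆_)

-- The classical axioms of the real numbers, which determine them up to a
-- unique isomorphism. The standard library has no type of reals, so they
-- are introduced as an arbitrary model of these axioms.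
record CompleteOrderedField : Set (lsuc 0ℓ) where
  field
    commutativeRing : CommutativeRing 0ℓ 0ℓ

  open CommutativeRing commutativeRing public
    using (Carrier; _≈_; _+_; _*_; -_; _-_; 0#; 1#; +-rawMonoid)

  infix 4 _<_

  field
    _<_                : Rel Carrier 0ℓ
    isStrictTotalOrder : IsStrictTotalOrder _≈_ _<_
    0<1                : 0# < 1#
    +-monoʳ-<          : ∀ x {y z} → y < z → (x + y) < (x + z)
    *-pos              : ∀ {x y} → 0# < x → 0# < y → 0# < (x * y)
    inverse            : ∀ x → ¬ (x ≈ 0#) → ∃[ y ] (x * y) ≈ 1#

  open StrictToNonStrict _≈_ _<_ public using (_≤_)

  UpperBound : Pred Carrier 0ℓ → Pred Carrier 0ℓ
  UpperBound A b = ∀ x → x ∈ A → x ≤ b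

  field
    complete : (A : Pred Carrier 0ℓ) → ∃ A → ∃ (UpperBound A) →
               ∃[ s ] UpperBound A s × (∀ b → UpperBound A b → s ≤ b)

module Plane (ℝ : CompleteOrderedField) where
  open CompleteOrderedField ℝ
  open RawMonoidDefinitions +-rawMonoid using (sum)

  Point : Set
  Point = Carrier × Carrier

  infix 4 _≋_

  _≋_ : Rel Point 0ℓ
  _≋_ = Pointwise _≈_ _≈_

  distance² : Point → Point → Carrier
  distance² (x₁ , y₁) (x₂ , y₂) =
    ((x₁ - x₂) * (x₁ - x₂)) + ((y₁ - y₂) * (y₁ - y₂))

  Ball : Point → Carrier → Pred Point 0ℓ
  Ball p r q = distance² p q < (r * r)

  Interior : Pred Point 0ℓ → Pred Point 0ℓ
  Interior A p = ∃[ r ] 0# < r × Ball p r ⊆ A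

  Closure : Pred Point 0ℓ → Pred Point 0ℓ
  Closure A p = ∀ r → 0# < r → ∃[ q ] q ∈ Ball p r × q ∈ A

  Boundary : Pred Point 0ℓ → Pred Point 0ℓ
  Boundary A p = p ∈ Closure A × p ∉ Interior A

  conv : Pred Point 0ℓ → Pred Point 0ℓ
  conv A p =
    ∃[ m ] Σ[ q ∈ Vector Point m ] Σ[ w ∈ Vector Carrier m ]
      (∀ i → q i ∈ A) ×
      (∀ i → 0# ≤ w i) ×
      sum w ≈ 1# ×
      p ≋ (sum (λ i → w i * proj₁ (q i)) , sum (λ i → w i * proj₂ (q i)))

  ConvexPosition : Pred Point 0ℓ → Set
  ConvexPosition A = A ⊆ Boundary (conv A)

  record Line : Set where
    field
      a b c         : Carrier
      nondegenerate : ¬ (a ≈ 0# × b ≈ 0#)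

  _liesOn_ : Point → Line → Set
  (x , y) liesOn ℓ = ((a * x) + (b * y)) ≈ c
    where open Line ℓ

  Collinear : Point → Point → Point → Set
  Collinear p q r = ∃[ ℓ ] p liesOn ℓ × q liesOn ℓ × r liesOn ℓ

  -- A set of exactly n points, given by an enumeration without repetition.
  record PointSet (n : ℕ) : Set where
    field
      point    : Fin n → Point
      distinct : Injective _≡_ _≋_ point

  open PointSet public

  GeneralPosition : ∀ {n} → PointSet n → Set
  GeneralPosition P = ∀ i j k → i ≢ j → j ≢ k → i ≢ k →
    ¬ Collinear (point P i) (point P j) (point P k)

  subsetOf : ∀ {n} → PointSet n → Subset.Subset n → Pred Point 0ℓ
  subsetOf P S p = ∃[ i ] i Subset.∈ S × p ≋ point P i

  ContainsConvexPosition : ∀ {n} → ℤ → PointSet n → Set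
  ContainsConvexPosition k P =
    ∃[ S ] k ℤ.≤ + Subset.∣ S ∣ × ConvexPosition (subsetOf P S)

  Sufficient : ℤ → ℕ → Set
  Sufficient k N = ∀ {n} (P : PointSet n) → N ℕ.≤ n →
    GeneralPosition P → ContainsConvexPosition k P

  -- IsES k N says that ES(k) = N. A function ES would need the
  -- Erdős–Szekeres theorem and classical logic for the minimum to exist.
  IsES : ℤ → ℕ → Set
  IsES k N = Sufficient k N × (∀ M → Sufficient k M → N ℕ.≤ M)

{-# OPTIONS --safe #-}

-- A point of a finite set A lies outside the interior of conv A exactly when some line
-- through it has all of A weakly on one side. Move the i-th point of P to
-- (x + tτ, y + tτ²) with τ = i: each orientation determinant becomes a quadratic in t whose
-- leading coefficient is a Vandermonde determinant, so for small t > 0 no determinant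
-- vanishes and every strict orientation of P survives. In the perturbed set P′, take S in
-- convex position and i ∈ S. No triangle of S contains i in its interior, so "k is to the
-- left of the ray from i through j" is a transitive tournament in j and k; its source j
-- gives a line through i and j with S on one side. Since only zero determinants of P
-- changed sign, the same j supports i in P, and S is in convex position in P as well.
module Submission where

open import Algebra.Bundles using (CommutativeRing)
import Algebra.Properties.AbelianGroup as AbelianGroupProperties
import Algebra.Properties.Ring as RingProperties
import Algebra.Properties.Semiring.Mult.TCOptimised as Mult
import Algebra.Solver.Ring as RingSolver
open import Algebra.Solver.Ring.AlmostCommutativeRing
  using (fromCommutativeRing; _-Raw-AlmostCommutative⟶_)
open import Data.Empty using (⊥; ⊥-elim)
open import Data.Fin using (Fin; zero; suc; toℕ)
import Data.Fin.Properties as Fin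
open import Data.Fin.Subset using (Subset; _∈_)
open import Data.Fin.Subset.Properties using (_∈?_)
open import Data.Integer using (ℤ; +_; -[1+_]; _⊖_)
import Data.Integer as ℤ
import Data.Integer.Properties as ℤ
open import Data.Maybe using (Maybe; just; nothing)
open import Data.Nat using (ℕ; zero; suc)
import Data.Nat as ℕ
import Data.Nat.Properties as ℕ
open import Data.Product using (_×_; _,_; proj₁; proj₂; ∃-syntax)
open import Data.Sum as Sum using (_⊎_; inj₁; inj₂; reduce)
open import Data.Vec.Functional using ([]; _∷_)
open import Defs
open import Function using (_∘_)
open import Level using (0ℓ)
open import Relation.Binary using (Rel; tri<; tri≈; tri>; IsStrictTotalOrder)
open import Relation.Binary.PropositionalEquality as ≡ using (_≡_; _≢_)
open import Relation.Nullary using (¬_; Dec; yes; no)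
open import Relation.Nullary.Decidable using (¬?; _×-dec_; decidable-stable)
open import Relation.Unary using (Pred; Decidable) renaming (_∈_ to _∈ₚ_; _∉_ to _∉ₚ_)

-- The ring solver must decide equality of coefficients by computation, which is impossible
-- with coefficients in an abstract ring.
module IntegerCoefficients (R : CommutativeRing 0ℓ 0ℓ) where
  open CommutativeRing R
  open Mult semiring using (1+×; ×1-homo-*; ×-homo-+) renaming (_×_ to _·_)
  open RingProperties ring
  open AbelianGroupProperties +-abelianGroup using (⁻¹-∙-comm)
  open import Relation.Binary.Reasoning.Setoid setoid

  -- The canonical ring homomorphism from the integers.

  fromℕ : ℕ → Carrier
  fromℕ n = n · 1#

  fromℤ : ℤ → Carrier
  fromℤ (+ n)    = fromℕ n
  fromℤ -[1+ n ] = - fromℕ (suc n)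

  -- Integers of opposite signs are added through `⊖`, so this is the mixed-sign case of `fromℤ-+`.
  -- The induction lowers both arguments at once and pays for it by inserting `1# - 1#`.
  fromℤ-⊖ : ∀ m n → fromℤ (m ⊖ n) ≈ fromℕ m - fromℕ n
  fromℤ-⊖ zero    zero    = sym (-‿inverseʳ 0#)
  fromℤ-⊖ zero    (suc n) = sym (+-identityˡ _)
  fromℤ-⊖ (suc m) zero    = sym (trans (+-congˡ -0#≈0#) (+-identityʳ _))
  fromℤ-⊖ (suc m) (suc n) = begin
    fromℤ (suc m ⊖ suc n)                  ≡⟨ ≡.cong fromℤ (ℤ.[1+m]⊖[1+n]≡m⊖n m n) ⟩
    fromℤ (m ⊖ n)                          ≈⟨ fromℤ-⊖ m n ⟩
    fromℕ m - fromℕ n                      ≈⟨ +-congʳ (+-identityʳ _) ⟨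
    (fromℕ m + 0#) - fromℕ n               ≈⟨ +-congʳ (+-congˡ (-‿inverseʳ 1#)) ⟨
    (fromℕ m + (1# - 1#)) - fromℕ n        ≈⟨ +-congʳ (+-assoc _ _ _) ⟨
    ((fromℕ m + 1#) - 1#) - fromℕ n        ≈⟨ +-assoc _ _ _ ⟩
    (fromℕ m + 1#) + (- 1# - fromℕ n)      ≈⟨ +-cong (+-comm _ _) (⁻¹-∙-comm _ _) ⟩
    (1# + fromℕ m) - (1# + fromℕ n)        ≈⟨ +-cong (1+× m 1#) (-‿cong (1+× n 1#)) ⟨
    fromℕ (suc m) - fromℕ (suc n)          ∎

  fromℤ-+ : ∀ i j → fromℤ (i ℤ.+ j) ≈ fromℤ i + fromℤ j
  fromℤ-+ (+ m)    (+ n)    = ×-homo-+ 1# m n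
  fromℤ-+ (+ m)    -[1+ n ] = fromℤ-⊖ m (suc n)
  fromℤ-+ -[1+ m ] (+ n)    = trans (fromℤ-⊖ n (suc m)) (+-comm _ _)
  fromℤ-+ -[1+ m ] -[1+ n ] = begin
    - fromℕ (suc (suc (m ℕ.+ n)))          ≡⟨ ≡.cong (λ k → - fromℕ (suc k)) (≡.sym (ℕ.+-suc m n)) ⟩
    - fromℕ (suc m ℕ.+ suc n)              ≈⟨ -‿cong (×-homo-+ 1# (suc m) (suc n)) ⟩
    - (fromℕ (suc m) + fromℕ (suc n))      ≈⟨ ⁻¹-∙-comm _ _ ⟨
    - fromℕ (suc m) - fromℕ (suc n)        ∎

  fromℤ-neg : ∀ i → fromℤ (ℤ.- i) ≈ - fromℤ i
  fromℤ-neg (+ zero)  = sym -0#≈0#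
  fromℤ-neg (+ suc n) = refl
  fromℤ-neg -[1+ n ]  = sym (-‿involutive _)

  -- The sign of the left factor is pulled out here and that of the right factor in `fromℤ-*`, which
  -- avoids treating four combinations of signs.
  fromℤ-*-+ : ∀ i n → fromℤ (i ℤ.* + n) ≈ fromℤ i * fromℕ n
  fromℤ-*-+ (+ m)    n = begin
    fromℤ (+ m ℤ.* + n)  ≡⟨ ≡.cong fromℤ (≡.sym (ℤ.pos-* m n)) ⟩
    fromℕ (m ℕ.* n)      ≈⟨ ×1-homo-* m n ⟩
    fromℕ m * fromℕ n    ∎
  fromℤ-*-+ -[1+ m ] n = begin
    fromℤ (-[1+ m ] ℤ.* + n)           ≡⟨ ≡.cong fromℤ (≡.sym (ℤ.neg-distribˡ-* (+ suc m) (+ n))) ⟩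
    fromℤ (ℤ.- (+ suc m ℤ.* + n))      ≈⟨ fromℤ-neg (+ suc m ℤ.* + n) ⟩
    - fromℤ (+ suc m ℤ.* + n)          ≈⟨ -‿cong (fromℤ-*-+ (+ suc m) n) ⟩
    - (fromℕ (suc m) * fromℕ n)        ≈⟨ -‿distribˡ-* _ _ ⟩
    - fromℕ (suc m) * fromℕ n          ∎

  fromℤ-* : ∀ i j → fromℤ (i ℤ.* j) ≈ fromℤ i * fromℤ j
  fromℤ-* i (+ n)    = fromℤ-*-+ i n
  fromℤ-* i -[1+ n ] = begin
    fromℤ (i ℤ.* -[1+ n ])        ≡⟨ ≡.cong fromℤ (≡.sym (ℤ.neg-distribʳ-* i (+ suc n))) ⟩
    fromℤ (ℤ.- (i ℤ.* + suc n))   ≈⟨ fromℤ-neg (i ℤ.* + suc n) ⟩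
    - fromℤ (i ℤ.* + suc n)       ≈⟨ -‿cong (fromℤ-*-+ i (suc n)) ⟩
    - (fromℤ i * fromℕ (suc n))   ≈⟨ -‿distribʳ-* _ _ ⟩
    fromℤ i * - fromℕ (suc n)     ∎

  morphism : ℤ.+-*-rawRing -Raw-AlmostCommutative⟶ fromCommutativeRing R
  morphism = record
    { ⟦_⟧    = fromℤ
    ; +-homo = fromℤ-+
    ; *-homo = fromℤ-*
    ; -‿homo = fromℤ-neg
    ; 0-homo = refl
    ; 1-homo = refl
    }

  coefficient≟ : ∀ i j → Maybe (fromℤ i ≈ fromℤ j)
  coefficient≟ i j with i ℤ.≟ j
  ... | yes i≡j = just (reflexive (≡.cong fromℤ i≡j))
  ... | no  _   = nothing

  open RingSolver ℤ.+-*-rawRing (fromCommutativeRing R) morphism coefficient≟ public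
    using (solve; _:=_; _:+_; _:*_; _:-_; :-_; con; Polynomial)

module OrderedField (ℝ : CompleteOrderedField) where
  open CompleteOrderedField ℝ
    using (commutativeRing; _<_; _≤_; isStrictTotalOrder; 0<1; +-monoʳ-<; *-pos; inverse)
  open CommutativeRing commutativeRing hiding (zero)
  open IsStrictTotalOrder isStrictTotalOrder
    using (compare; irrefl; asym; _≟_; <-respʳ-≈; <-respˡ-≈) renaming (trans to <-trans)
  open IntegerCoefficients commutativeRing
  open Mult semiring using (1+×)

  -- Signs, products and inverses in an ordered field.

  0≤-cong : ∀ {x y} → x ≈ y → 0# ≤ x → 0# ≤ y
  0≤-cong x≈y (inj₁ 0<x) = inj₁ (<-respʳ-≈ x≈y 0<x)
  0≤-cong x≈y (inj₂ 0≈x) = inj₂ (trans 0≈x x≈y)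

  <⇒0<- : ∀ {x y} → x < y → 0# < y - x
  <⇒0<- {x} {y} x<y =
    <-respˡ-≈ (-‿inverseˡ x) (<-respʳ-≈ (+-comm (- x) y) (+-monoʳ-< (- x) x<y))

  0<-⇒< : ∀ {x y} → 0# < y - x → x < y
  0<-⇒< {x} {y} 0<y-x =
    <-respˡ-≈ (+-identityʳ x)
      (<-respʳ-≈ (solve 2 (λ x y → x :+ (y :- x) := y) refl x y) (+-monoʳ-< x 0<y-x))

  ≤⇒0≤- : ∀ {x y} → x ≤ y → 0# ≤ y - x
  ≤⇒0≤- (inj₁ x<y)         = inj₁ (<⇒0<- x<y)
  ≤⇒0≤- {x} {y} (inj₂ x≈y) = inj₂ (sym (trans (+-congˡ (-‿cong x≈y)) (-‿inverseʳ y)))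

  0≮⇒0≤-neg : ∀ {x} → ¬ (0# < x) → 0# ≤ - x
  0≮⇒0≤-neg {x} 0≮x = 0≤-cong (+-identityˡ (- x)) (≤⇒0≤- x≤0)
    where
    x≤0 : x ≤ 0#
    x≤0 with compare x 0#
    ... | tri< x<0 _ _ = inj₁ x<0
    ... | tri≈ _ x≈0 _ = inj₂ x≈0
    ... | tri> _ _ 0<x = ⊥-elim (0≮x 0<x)

  0<⇒≉0 : ∀ {x} → 0# < x → x ≉ 0#
  0<⇒≉0 0<x x≈0 = irrefl (sym x≈0) 0<x

  0≤∧≉0⇒0< : ∀ {x} → 0# ≤ x → x ≉ 0# → 0# < x
  0≤∧≉0⇒0< (inj₁ 0<x) _   = 0<x
  0≤∧≉0⇒0< (inj₂ 0≈x) x≉0 = ⊥-elim (x≉0 (sym 0≈x))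

  neg⇒0<- : ∀ {x} → x < 0# → 0# < - x
  neg⇒0<- {x} x<0 = <-respʳ-≈ (+-identityˡ (- x)) (<⇒0<- x<0)

  +-pos-nonneg : ∀ {x y} → 0# < x → 0# ≤ y → 0# < x + y
  +-pos-nonneg {x} {y} 0<x (inj₁ 0<y) =
    <-trans 0<x (<-respˡ-≈ (+-identityʳ x) (+-monoʳ-< x 0<y))
  +-pos-nonneg {x} 0<x (inj₂ 0≈y) =
    <-respʳ-≈ (trans (sym (+-identityʳ x)) (+-congˡ 0≈y)) 0<x

  +-pos : ∀ {x y} → 0# < x → 0# < y → 0# < x + y
  +-pos 0<x 0<y = +-pos-nonneg 0<x (inj₁ 0<y)

  +-nonneg : ∀ {x y} → 0# ≤ x → 0# ≤ y → 0# ≤ x + y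
  +-nonneg (inj₁ 0<x) 0≤y             = inj₁ (+-pos-nonneg 0<x 0≤y)
  +-nonneg {x} {y} (inj₂ 0≈x) 0≤y     = 0≤-cong (trans (sym (+-identityˡ y)) (+-congʳ 0≈x)) 0≤y

  *-nonneg : ∀ {x y} → 0# ≤ x → 0# ≤ y → 0# ≤ x * y
  *-nonneg (inj₁ 0<x) (inj₁ 0<y)     = inj₁ (*-pos 0<x 0<y)
  *-nonneg {x} (inj₁ _) (inj₂ 0≈y)   = inj₂ (trans (sym (zeroʳ x)) (*-congˡ 0≈y))
  *-nonneg {_} {y} (inj₂ 0≈x) _      = inj₂ (trans (sym (zeroˡ y)) (*-congʳ 0≈x))

  square-pos : ∀ {x} → x ≉ 0# → 0# < x * x
  square-pos {x} x≉0 with compare x 0#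
  ... | tri< x<0 _ _ = <-respʳ-≈ (solve 1 (λ x → (:- x) :* (:- x) := x :* x) refl x)
                         (*-pos (neg⇒0<- x<0) (neg⇒0<- x<0))
  ... | tri≈ _ x≈0 _ = ⊥-elim (x≉0 x≈0)
  ... | tri> _ _ 0<x = *-pos 0<x 0<x

  square-nonneg : ∀ x → 0# ≤ x * x
  square-nonneg x with x ≟ 0#
  ... | yes x≈0 = inj₂ (sym (trans (*-congʳ x≈0) (zeroˡ x)))
  ... | no  x≉0 = inj₁ (square-pos x≉0)

  *-≉0 : ∀ {x y} → x ≉ 0# → y ≉ 0# → x * y ≉ 0#
  *-≉0 {x} {y} x≉0 y≉0 xy≈0 with inverse x x≉0
  ... | x⁻¹ , xx⁻¹≈1 = y≉0 (begin
    y                ≈⟨ *-identityˡ y ⟨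
    1# * y           ≈⟨ *-congʳ xx⁻¹≈1 ⟨
    x * x⁻¹ * y      ≈⟨ solve 3 (λ x z y → x :* z :* y := z :* (x :* y)) refl x x⁻¹ y ⟩
    x⁻¹ * (x * y)    ≈⟨ *-congˡ xy≈0 ⟩
    x⁻¹ * 0#         ≈⟨ zeroʳ x⁻¹ ⟩
    0#               ∎)
    where open import Relation.Binary.Reasoning.Setoid setoid

  -‿≉0 : ∀ {x y} → x ≉ y → x - y ≉ 0#
  -‿≉0 {x} {y} x≉y x-y≈0 =
    x≉y (AbelianGroupProperties.x∙y⁻¹≈ε⇒x≈y +-abelianGroup x y x-y≈0)

  inverse-pos : ∀ {x} → 0# < x → ∃[ y ] (0# < y) × (x * y ≈ 1#)
  inverse-pos {x} 0<x with inverse x (0<⇒≉0 0<x)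
  ... | y , xy≈1 with compare 0# y
  ...   | tri< 0<y _ _ = y , 0<y , xy≈1
  ...   | tri≈ _ 0≈y _ = ⊥-elim (irrefl (trans (sym (zeroʳ x)) (trans (*-congˡ 0≈y) xy≈1)) 0<1)
  -- If `y` were negative, `x * (- y)` would be positive and equal to `0# - 1#`, so `1# < 0#`.
  ...   | tri> _ _ y<0 = ⊥-elim (asym 0<1 (0<-⇒< (<-respʳ-≈ x[-y]≈0-1 (*-pos 0<x (neg⇒0<- y<0)))))
    where
    x[-y]≈0-1 : x * (- y) ≈ 0# - 1#
    x[-y]≈0-1 = trans (solve 2 (λ x y → x :* (:- y) := con (+ 0) :- x :* y) refl x y)
                      (+-congˡ (-‿cong xy≈1))

  -- Characteristic zero.

  fromℕ-nonneg : ∀ n → 0# ≤ fromℕ n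
  fromℕ-nonneg zero    = inj₂ refl
  fromℕ-nonneg (suc n) = 0≤-cong (sym (1+× n 1#)) (+-nonneg (inj₁ 0<1) (fromℕ-nonneg n))

  fromℕ-suc≉0 : ∀ n → fromℕ (suc n) ≉ 0#
  fromℕ-suc≉0 n = 0<⇒≉0 (<-respʳ-≈ (sym (1+× n 1#)) (+-pos-nonneg 0<1 (fromℕ-nonneg n)))

  -- Keeps the perturbation parameters of different points apart.
  fromℕ-injective : ∀ m n → fromℕ m ≈ fromℕ n → m ≡ n
  fromℕ-injective zero    zero    _  = ≡.refl
  fromℕ-injective zero    (suc n) eq = ⊥-elim (fromℕ-suc≉0 n (sym eq))
  fromℕ-injective (suc m) zero    eq = ⊥-elim (fromℕ-suc≉0 m eq)
  fromℕ-injective (suc m) (suc n) eq = ≡.cong suc (fromℕ-injective m n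
    (AbelianGroupProperties.∙-cancelˡ +-abelianGroup 1# _ _
      (trans (sym (1+× m 1#)) (trans eq (1+× n 1#)))))

  -- Properties of all sufficiently small positive numbers.

  -- Stands in for a limit from the right at zero and is closed under finite conjunctions. The bound
  -- `t ≤ δ` is not strict, so that `δ` itself is a witness in `forSmall-witness`.
  ForSmall : Pred Carrier 0ℓ → Set
  ForSmall Q = ∃[ δ ] (0# < δ) × (∀ t → 0# < t → t ≤ δ → Q t)

  private variable
    Q Q′ : Pred Carrier 0ℓ

  forSmall-all : (∀ t → 0# < t → Q t) → ForSmall Q
  forSmall-all q = 1# , 0<1 , λ t 0<t _ → q t 0<t

  forSmall-map : (∀ t → 0# < t → Q t → Q′ t) → ForSmall Q → ForSmall Q′
  forSmall-map f (δ , 0<δ , q) = δ , 0<δ , λ t 0<t t≤δ → f t 0<t (q t 0<t t≤δ)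

  forSmall-witness : ForSmall Q → ∃[ t ] (0# < t) × Q t
  forSmall-witness (δ , 0<δ , q) = δ , 0<δ , q δ 0<δ (inj₂ refl)

  ≤-<-trans : ∀ {x y z} → x ≤ y → y < z → x < z
  ≤-<-trans (inj₁ x<y) y<z = <-trans x<y y<z
  ≤-<-trans (inj₂ x≈y) y<z = <-respˡ-≈ (sym x≈y) y<z

  forSmall-× : ForSmall Q → ForSmall Q′ → ForSmall (λ t → Q t × Q′ t)
  forSmall-× (δ , 0<δ , q) (δ′ , 0<δ′ , q′) with compare δ δ′
  ... | tri< δ<δ′ _ _ = δ , 0<δ , λ t 0<t t≤δ → q t 0<t t≤δ , q′ t 0<t (inj₁ (≤-<-trans t≤δ δ<δ′))
  ... | tri> _ _ δ′<δ = δ′ , 0<δ′ , λ t 0<t t≤δ′ → q t 0<t (inj₁ (≤-<-trans t≤δ′ δ′<δ)) , q′ t 0<t t≤δ′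
  ... | tri≈ _ δ≈δ′ _ = δ , 0<δ , λ t 0<t t≤δ → q t 0<t t≤δ , q′ t 0<t (≤-resp t≤δ)
    where
    ≤-resp : ∀ {t} → t ≤ δ → t ≤ δ′
    ≤-resp (inj₁ t<δ) = inj₁ (<-respʳ-≈ δ≈δ′ t<δ)
    ≤-resp (inj₂ t≈δ) = inj₂ (trans t≈δ δ≈δ′)

  forSmall-∀ : ∀ {n} {Q : Fin n → Pred Carrier 0ℓ} →
               (∀ i → ForSmall (Q i)) → ForSmall (λ t → ∀ i → Q i t)
  forSmall-∀ {zero}  q = forSmall-all λ _ _ ()
  forSmall-∀ {suc n} q =
    forSmall-map (λ { _ _ (q₀ , q₊) zero → q₀ ; _ _ (q₀ , q₊) (suc i) → q₊ i })
      (forSmall-× (q zero) (forSmall-∀ (λ i → q (suc i))))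

  -- Signs of polynomials of degree at most two near zero.

  linear-pos : ∀ {c} d → 0# < c → ForSmall (λ t → 0# < c + t * d)
  linear-pos {c} d 0<c with compare d 0#
  ... | tri≈ _ d≈0 _ = forSmall-all λ t _ →
        <-respʳ-≈ (sym (trans (+-congˡ (trans (*-congˡ d≈0) (zeroʳ t))) (+-identityʳ c))) 0<c
  ... | tri> _ _ 0<d = forSmall-all λ t 0<t → +-pos 0<c (*-pos 0<t 0<d)
  ... | tri< d<0 _ _ with inverse-pos (+-pos 0<1 (neg⇒0<- d<0))
  -- The bound is c / (1 - d) rather than the root c / (- d), so the value stays strictly positive
  -- at the bound itself: there it is c / (1 - d) again.
  ...   | y , 0<y , [1-d]y≈1 = c * y , *-pos 0<c 0<y , λ t 0<t t≤cy →
    <-respʳ-≈ (identity t)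
      (+-pos-nonneg (*-pos 0<c 0<y) (*-nonneg (≤⇒0≤- t≤cy) (inj₁ (neg⇒0<- d<0))))
    where
    open import Relation.Binary.Reasoning.Setoid setoid
    identity : ∀ t → c * y + (c * y - t) * (- d) ≈ c + t * d
    identity t = begin
      c * y + (c * y - t) * (- d)
        ≈⟨ solve 4 (λ c y t d → c :* y :+ (c :* y :- t) :* (:- d)
                             := c :* ((con (+ 1) :- d) :* y) :+ t :* d) refl c y t d ⟩
      c * ((1# - d) * y) + t * d   ≈⟨ +-congʳ (*-congˡ [1-d]y≈1) ⟩
      c * 1# + t * d               ≈⟨ +-congʳ (*-identityʳ c) ⟩
      c + t * d                    ∎

  -- Subtracting and adding `t` splits the value into c + t(d - 1) and t(1 + te), and `linear-pos`
  -- applies to both c + t(d - 1) and 1 + te.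
  quadratic-pos : ∀ {c} d e → 0# < c → ForSmall (λ t → 0# < c + t * (d + t * e))
  quadratic-pos {c} d e 0<c = forSmall-map
    (λ t 0<t (p , q) → <-respʳ-≈
      (solve 4 (λ c d e t → c :+ t :* (d :- con (+ 1)) :+ t :* (con (+ 1) :+ t :* e)
                         := c :+ t :* (d :+ t :* e)) refl c d e t)
      (+-pos p (*-pos 0<t q)))
    (forSmall-× (linear-pos (d - 1#) 0<c) (linear-pos e 0<1))

  quadratic-≉0-const : ∀ {c} d e → c ≉ 0# → ForSmall (λ t → c + t * (d + t * e) ≉ 0#)
  quadratic-≉0-const {c} d e c≉0 with compare c 0#
  ... | tri≈ _ c≈0 _ = ⊥-elim (c≉0 c≈0)
  ... | tri> _ _ 0<c = forSmall-map (λ _ _ → 0<⇒≉0) (quadratic-pos d e 0<c)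
  ... | tri< c<0 _ _ = forSmall-map
    (λ t _ 0<neg value≈0 → 0<⇒≉0 0<neg (begin
      (- c) + t * ((- d) + t * (- e))
        ≈⟨ solve 4 (λ c d e t → :- c :+ t :* (:- d :+ t :* (:- e))
                             := :- (c :+ t :* (d :+ t :* e))) refl c d e t ⟩
      - (c + t * (d + t * e))   ≈⟨ -‿cong value≈0 ⟩
      - 0#                      ≈⟨ RingProperties.-0#≈0# ring ⟩
      0#                        ∎))
    (quadratic-pos (- d) (- e) (neg⇒0<- c<0))
    where open import Relation.Binary.Reasoning.Setoid setoid

  -- The lowest nonvanishing coefficient decides: once the power of `t` in front of it is factored
  -- out, what remains has a nonzero constant term.
  quadratic-≉0 : ∀ {c d e} → ¬ (c ≈ 0# × d ≈ 0# × e ≈ 0#) →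
                 ForSmall (λ t → c + t * (d + t * e) ≉ 0#)
  quadratic-≉0 {c} {d} {e} nonzero with c ≟ 0# | d ≟ 0#
  ... | no  c≉0 | _       = quadratic-≉0-const d e c≉0
  ... | yes c≈0 | no  d≉0 = forSmall-map
    (λ t 0<t factor≉0 value≈0 → *-≉0 (0<⇒≉0 0<t) factor≉0 (begin
      t * (d + t * (e + t * 0#))
        ≈⟨ solve 3 (λ d e t → t :* (d :+ t :* (e :+ t :* con (+ 0)))
                           := con (+ 0) :+ t :* (d :+ t :* e)) refl d e t ⟩
      0# + t * (d + t * e)     ≈⟨ +-congʳ c≈0 ⟨
      c + t * (d + t * e)      ≈⟨ value≈0 ⟩
      0#                       ∎))
    (quadratic-≉0-const e 0# d≉0)
    where open import Relation.Binary.Reasoning.Setoid setoid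
  ... | yes c≈0 | yes d≈0 = forSmall-all λ t 0<t value≈0 →
    *-≉0 (0<⇒≉0 0<t) (*-≉0 (0<⇒≉0 0<t) (λ e≈0 → nonzero (c≈0 , d≈0 , e≈0))) (begin
      t * (t * e)              ≈⟨ *-congˡ (+-identityˡ (t * e)) ⟨
      t * (0# + t * e)         ≈⟨ *-congˡ (+-congʳ d≈0) ⟨
      t * (d + t * e)          ≈⟨ +-identityˡ _ ⟨
      0# + t * (d + t * e)     ≈⟨ +-congʳ c≈0 ⟨
      c + t * (d + t * e)      ≈⟨ value≈0 ⟩
      0#                       ∎)
    where open import Relation.Binary.Reasoning.Setoid setoid

  -- The bound `δ` has to be fixed before a proof of `A` is given; deciding `A` makes this possible.
  forSmall-→ : ∀ {A : Set} → Dec A → (A → ForSmall Q) → ForSmall (λ t → A → Q t)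
  forSmall-→ (yes a) q = forSmall-map (λ _ _ qt _ → qt) (q a)
  forSmall-→ (no ¬a) q = forSmall-all λ _ _ a → ⊥-elim (¬a a)

-- Sources of finite transitive tournaments.

-- By induction, the source of the remaining indices only has to be compared with `zero`; if `zero`
-- wins, transitivity carries its win over to all the others.
source : ∀ {n} {Q : Pred (Fin n) 0ℓ} (_⊑_ : Rel (Fin n) 0ℓ) → Decidable Q →
         (∀ i j → Q i → Q j → i ⊑ j ⊎ j ⊑ i) →
         (∀ i j k → Q i → Q j → Q k → i ⊑ j → j ⊑ k → i ⊑ k) →
         (∀ i → ¬ Q i) ⊎ ∃[ i ] Q i × (∀ j → Q j → i ⊑ j)
source {zero}  _⊑_ Q? total transitive = inj₁ λ ()
source {suc n} _⊑_ Q? total transitive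
  with Q? zero | source (λ i j → suc i ⊑ suc j) (λ i → Q? (suc i))
                   (λ i j → total (suc i) (suc j))
                   (λ i j k → transitive (suc i) (suc j) (suc k))
... | no ¬q₀ | inj₁ none = inj₁ λ { zero → ¬q₀ ; (suc i) → none i }
... | no ¬q₀ | inj₂ (i , qᵢ , i⊑) =
  inj₂ (suc i , qᵢ , λ { zero q₀ → ⊥-elim (¬q₀ q₀) ; (suc j) → i⊑ j })
... | yes q₀ | inj₁ none =
  -- Totality at a repeated index gives reflexivity: both alternatives are the same.
  inj₂ (zero , q₀ , λ { zero _ → reduce (total zero zero q₀ q₀) ; (suc j) qⱼ → ⊥-elim (none j qⱼ) })
... | yes q₀ | inj₂ (i , qᵢ , i⊑) with total zero (suc i) q₀ qᵢ
...   | inj₂ i⊑0 = inj₂ (suc i , qᵢ , λ { zero _ → i⊑0 ; (suc j) → i⊑ j })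
...   | inj₁ 0⊑i = inj₂ (zero , q₀ , λ
  { zero    _  → reduce (total zero zero q₀ q₀)
  ; (suc j) qⱼ → transitive _ _ _ q₀ qᵢ qⱼ 0⊑i (i⊑ j qⱼ) })

module Geometry (ℝ : CompleteOrderedField) where
  open CompleteOrderedField ℝ
    using (commutativeRing; _<_; _≤_; isStrictTotalOrder; 0<1; *-pos)
  open CommutativeRing commutativeRing hiding (zero)
  open IsStrictTotalOrder isStrictTotalOrder using (irrefl; _≟_; _<?_; <-respʳ-≈; <-respˡ-≈)
  open IntegerCoefficients commutativeRing
  open OrderedField ℝ
  open Plane ℝ
  open import Algebra.Definitions.RawMonoid +-rawMonoid using (sum)
  open import Relation.Binary.Reasoning.Setoid setoid

  -- Orientation of triples of points.

  -- Twice the signed area of the triangle, positive when the three points run counterclockwise.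
  det : Point → Point → Point → Carrier
  det (x₁ , y₁) (x₂ , y₂) (x₃ , y₃) = (x₂ - x₁) * (y₃ - y₁) - (y₂ - y₁) * (x₃ - x₁)

  det-poly : ∀ {m} (x₁ y₁ x₂ y₂ x₃ y₃ : Polynomial m) → Polynomial m
  det-poly x₁ y₁ x₂ y₂ x₃ y₃ = (x₂ :- x₁) :* (y₃ :- y₁) :- (y₂ :- y₁) :* (x₃ :- x₁)

  det-swap : ∀ p q r → det p r q ≈ - det p q r
  det-swap (x₁ , y₁) (x₂ , y₂) (x₃ , y₃) =
    solve 6 (λ x₁ y₁ x₂ y₂ x₃ y₃ →
      det-poly x₁ y₁ x₃ y₃ x₂ y₂ := :- det-poly x₁ y₁ x₂ y₂ x₃ y₃) refl x₁ y₁ x₂ y₂ x₃ y₃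

  -- As in Cramer's rule, both `a` and `b` times the determinant are combinations of differences of
  -- the values of ax + by at the three points. These differences vanish on the line, and one of `a`
  -- and `b` is invertible.
  collinear⇒det≈0 : ∀ {p q r} → Collinear p q r → det p q r ≈ 0#
  collinear⇒det≈0 {x₁ , y₁} {x₂ , y₂} {x₃ , y₃} (ℓ , p∈ℓ , q∈ℓ , r∈ℓ)
    with Line.a ℓ ≟ 0# | Line.b ℓ ≟ 0# | det (x₁ , y₁) (x₂ , y₂) (x₃ , y₃) ≟ 0#
  ... | _       | _       | yes d≈0 = d≈0
  ... | yes a≈0 | yes b≈0 | _       = ⊥-elim (Line.nondegenerate ℓ (a≈0 , b≈0))
  ... | no a≉0  | _       | no d≉0  = ⊥-elim (*-≉0 a≉0 d≉0 (begin
    a * det (x₁ , y₁) (x₂ , y₂) (x₃ , y₃)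
      ≈⟨ solve 8 (λ a b x₁ y₁ x₂ y₂ x₃ y₃ →
           a :* det-poly x₁ y₁ x₂ y₂ x₃ y₃
             := ((a :* x₂ :+ b :* y₂) :- (a :* x₁ :+ b :* y₁)) :* (y₃ :- y₁)
             :- ((a :* x₃ :+ b :* y₃) :- (a :* x₁ :+ b :* y₁)) :* (y₂ :- y₁))
           refl a b x₁ y₁ x₂ y₂ x₃ y₃ ⟩
    ((a * x₂ + b * y₂) - (a * x₁ + b * y₁)) * (y₃ - y₁) - ((a * x₃ + b * y₃) - (a * x₁ + b * y₁)) * (y₂ - y₁)
      ≈⟨ +-cong (*-congʳ (+-cong q∈ℓ (-‿cong p∈ℓ))) (-‿cong (*-congʳ (+-cong r∈ℓ (-‿cong p∈ℓ)))) ⟩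
    (c - c) * (y₃ - y₁) - (c - c) * (y₂ - y₁)
      ≈⟨ solve 3 (λ c s t → (c :- c) :* s :- (c :- c) :* t := con (+ 0)) refl c (y₃ - y₁) (y₂ - y₁) ⟩
    0# ∎))
    where open Line ℓ
  ... | _       | no b≉0  | no d≉0  = ⊥-elim (*-≉0 b≉0 d≉0 (begin
    b * det (x₁ , y₁) (x₂ , y₂) (x₃ , y₃)
      ≈⟨ solve 8 (λ a b x₁ y₁ x₂ y₂ x₃ y₃ →
           b :* det-poly x₁ y₁ x₂ y₂ x₃ y₃
             := ((a :* x₃ :+ b :* y₃) :- (a :* x₁ :+ b :* y₁)) :* (x₂ :- x₁)
             :- ((a :* x₂ :+ b :* y₂) :- (a :* x₁ :+ b :* y₁)) :* (x₃ :- x₁))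
           refl a b x₁ y₁ x₂ y₂ x₃ y₃ ⟩
    ((a * x₃ + b * y₃) - (a * x₁ + b * y₁)) * (x₂ - x₁) - ((a * x₂ + b * y₂) - (a * x₁ + b * y₁)) * (x₃ - x₁)
      ≈⟨ +-cong (*-congʳ (+-cong r∈ℓ (-‿cong p∈ℓ))) (-‿cong (*-congʳ (+-cong q∈ℓ (-‿cong p∈ℓ)))) ⟩
    (c - c) * (x₂ - x₁) - (c - c) * (x₃ - x₁)
      ≈⟨ solve 3 (λ c s t → (c :- c) :* s :- (c :- c) :* t := con (+ 0)) refl c (x₂ - x₁) (x₃ - x₁) ⟩
    0# ∎))
    where open Line ℓ

  -- Boundary and interior of a convex hull.

  ⊆Closure-conv : ∀ {A p} → p ∈ₚ A → p ∈ₚ Closure (conv A)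
  ⊆Closure-conv {A} {p@(x , y)} p∈A r 0<r =
    p , p∈Ball (*-pos 0<r 0<r) ,
    (1 , p ∷ [] , 1# ∷ [] , (λ { zero → p∈A }) , (λ { zero → inj₁ 0<1 }) ,
     +-identityʳ 1# , identity x , identity y)
    where
    p∈Ball : 0# < r * r → distance² p p < r * r
    p∈Ball = <-respˡ-≈
      (solve 2 (λ x y → con (+ 0) := (x :- x) :* (x :- x) :+ (y :- y) :* (y :- y)) refl x y)
    identity : ∀ z → z ≈ 1# * z + 0#
    identity = solve 1 (λ z → z := con (+ 1) :* z :+ con (+ 0)) refl

  -- The factor `sum w` will be 1 in the application. It is kept general because the tail of a
  -- convex combination need not have total weight 1, so the induction must allow any total.
  sum-affine-nonneg : ∀ {m} u v p (q : Fin m → Point) (w : Fin m → Carrier) →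
    (∀ i → 0# ≤ u * (proj₁ (q i) - proj₁ p) + v * (proj₂ (q i) - proj₂ p)) → (∀ i → 0# ≤ w i) →
    0# ≤ u * (sum (λ i → w i * proj₁ (q i)) - sum w * proj₁ p)
       + v * (sum (λ i → w i * proj₂ (q i)) - sum w * proj₂ p)
  sum-affine-nonneg {zero} u v (x , y) q w _ _ = inj₂
    (solve 4 (λ u v x y → con (+ 0) := u :* (con (+ 0) :- con (+ 0) :* x)
                                    :+ v :* (con (+ 0) :- con (+ 0) :* y)) refl u v x y)
  sum-affine-nonneg {suc m} u v (x , y) q w h 0≤w = 0≤-cong
    (solve 10 (λ u v x y qx qy w sw sx sy →
        w :* (u :* (qx :- x) :+ v :* (qy :- y)) :+ (u :* (sx :- sw :* x) :+ v :* (sy :- sw :* y))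
     := u :* ((w :* qx :+ sx) :- (w :+ sw) :* x) :+ v :* ((w :* qy :+ sy) :- (w :+ sw) :* y))
     refl u v x y (proj₁ (q zero)) (proj₂ (q zero)) (w zero) (sum (λ i → w (suc i)))
     (sum (λ i → w (suc i) * proj₁ (q (suc i)))) (sum (λ i → w (suc i) * proj₂ (q (suc i)))))
    (+-nonneg (*-nonneg (0≤w zero) (h zero))
              (sum-affine-nonneg u v (x , y) (λ i → q (suc i)) (λ i → w (suc i))
                (λ i → h (suc i)) (λ i → 0≤w (suc i))))

  norm-pos : ∀ {u v} → ¬ (u ≈ 0# × v ≈ 0#) → 0# < u * u + v * v
  norm-pos {u} {v} nonzero with u ≟ 0#
  ... | no  u≉0 = +-pos-nonneg (square-pos u≉0) (square-nonneg v)
  ... | yes u≈0 = <-respʳ-≈ (+-comm (v * v) (u * u))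
    (+-pos-nonneg (square-pos λ v≈0 → nonzero (u≈0 , v≈0)) (square-nonneg u))

  -- The linear form (u, v), measured from `p`, is nonnegative on `A` and hence on its hull. At `p`
  -- shifted by -t(u, v) it equals -t(u² + v²) < 0, so points outside the hull lie arbitrarily close
  -- to `p`.
  supported⇒∉Interior-conv : ∀ {A p} u v → ¬ (u ≈ 0# × v ≈ 0#) →
    (∀ {q} → q ∈ₚ A → 0# ≤ u * (proj₁ q - proj₁ p) + v * (proj₂ q - proj₂ p)) →
    p ∉ₚ Interior (conv A)
  supported⇒∉Interior-conv {A} {p@(x , y)} u v nonzero support (r , 0<r , ball⊆) =
    -- Here `t` is chosen with t²n < r², which puts the shifted point inside the ball.
    absurd (forSmall-witness (quadratic-pos 0# (- n) (*-pos 0<r 0<r)))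
    where
    n : Carrier
    n = u * u + v * v
    module _ (t : Carrier) where
      shifted : Point
      shifted = x - t * u , y - t * v

      shifted∈Ball : 0# < r * r + t * (0# + t * (- n)) → shifted ∈ₚ Ball p r
      shifted∈Ball small = 0<-⇒< (<-respʳ-≈ identity small)
        where
        identity : r * r + t * (0# + t * (- n)) ≈ r * r - distance² p shifted
        identity = solve 6 (λ x y u v r t →
            r :* r :+ t :* (con (+ 0) :+ t :* (:- (u :* u :+ v :* v)))
         := r :* r :- ((x :- (x :- t :* u)) :* (x :- (x :- t :* u))
                    :+ (y :- (y :- t :* v)) :* (y :- (y :- t :* v)))) refl x y u v r t

      shifted∉conv : 0# < t → shifted ∉ₚ conv A
      shifted∉conv 0<t (m , q , w , q∈A , 0≤w , Σw≈1 , x≈ , y≈) =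
        irrefl refl (<-respʳ-≈ (-‿inverseʳ (t * n))
          (+-pos-nonneg (*-pos 0<t (norm-pos nonzero)) (0≤-cong below
            (sum-affine-nonneg u v p q w (λ i → support (q∈A i)) 0≤w))))
        where
        below : u * (sum (λ i → w i * proj₁ (q i)) - sum w * x)
              + v * (sum (λ i → w i * proj₂ (q i)) - sum w * y) ≈ - (t * n)
        below = begin
          u * (sum (λ i → w i * proj₁ (q i)) - sum w * x) + v * (sum (λ i → w i * proj₂ (q i)) - sum w * y)
            ≈⟨ +-cong (*-congˡ (+-cong (sym x≈) (-‿cong (*-congʳ Σw≈1))))
                      (*-congˡ (+-cong (sym y≈) (-‿cong (*-congʳ Σw≈1)))) ⟩
          u * ((x - t * u) - 1# * x) + v * ((y - t * v) - 1# * y)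
            ≈⟨ solve 5 (λ x y u v t →
                 u :* ((x :- t :* u) :- con (+ 1) :* x) :+ v :* ((y :- t :* v) :- con (+ 1) :* y)
                   := :- (t :* (u :* u :+ v :* v))) refl x y u v t ⟩
          - (t * n) ∎

    absurd : ∃[ t ] (0# < t) × 0# < r * r + t * (0# + t * (- n)) → ⊥
    absurd (t , 0<t , small) = shifted∉conv t 0<t (ball⊆ (shifted∈Ball t small))

  -- |det q a b − det p a b| ≤ |a − b| |q − p| by Cauchy–Schwarz, stated through squares
  -- because |a − b| itself would need a square root.
  det-pos-near : ∀ p a b → 0# < det p a b →
    ForSmall (λ r → ∀ q → q ∈ₚ Ball p r → 0# < det q a b)
  det-pos-near p@(x , y) a@(a₁ , a₂) b@(b₁ , b₂) 0<C =
    -- The radius satisfies r²E < C², where `E` is the squared length of the side from `a` to `b`.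
    forSmall-map near (quadratic-pos 0# (- E) (*-pos 0<C 0<C))
    where
    C E : Carrier
    C = det p a b
    E = (a₁ - b₁) * (a₁ - b₁) + (a₂ - b₂) * (a₂ - b₂)
    near : ∀ r → 0# < r → 0# < C * C + r * (0# + r * (- E)) →
           ∀ q → q ∈ₚ Ball p r → 0# < det q a b
    near r _ small q@(q₁ , q₂) q∈ball with 0# <? det q a b
    ... | yes 0<det = 0<det
    -- If the determinant at `q` were not positive, the terms collected here would all be
    -- nonnegative and the first one positive, yet `cancel` shows that their sum is zero.
    ... | no  0≮det = ⊥-elim (irrefl refl (<-respʳ-≈ cancel
      (+-pos-nonneg small
        (+-nonneg (*-nonneg 0≤E (inj₁ (<⇒0<- q∈ball)))
          (+-nonneg (square-nonneg dot)
            (*-nonneg (0≮⇒0≤-neg 0≮det)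
              (+-nonneg (inj₁ (+-pos 0<C 0<C)) (0≮⇒0≤-neg 0≮det))))))))
      where
      dot : Carrier
      dot = (a₁ - b₁) * (q₁ - x) + (a₂ - b₂) * (q₂ - y)
      cross : Carrier
      cross = (a₁ - b₁) * (q₂ - y) - (a₂ - b₂) * (q₁ - x)
      difference : C - det q a b ≈ cross
      difference = solve 8 (λ x y a₁ a₂ b₁ b₂ q₁ q₂ →
        det-poly x y a₁ a₂ b₁ b₂ :- det-poly q₁ q₂ a₁ a₂ b₁ b₂
          := (a₁ :- b₁) :* (q₂ :- y) :- (a₂ :- b₂) :* (q₁ :- x))
        refl x y a₁ a₂ b₁ b₂ q₁ q₂
      0≤E : 0# ≤ E
      0≤E = +-nonneg (square-nonneg _) (square-nonneg _)
      cancel : C * C + r * (0# + r * (- E))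
             + (E * (r * r - distance² p q)
               + (dot * dot + (- det q a b) * ((C + C) + (- det q a b)))) ≈ 0#
      cancel = begin
        C * C + r * (0# + r * (- E))
          + (E * (r * r - distance² p q) + (dot * dot + (- det q a b) * ((C + C) + (- det q a b))))
          ≈⟨ solve 6 (λ C D E N d r →
               C :* C :+ r :* (con (+ 0) :+ r :* (:- E))
                 :+ (E :* (r :* r :- N) :+ (d :* d :+ (:- D) :* ((C :+ C) :+ (:- D))))
               := (d :* d :+ (C :- D) :* (C :- D)) :- E :* N)
             refl C (det q a b) E (distance² p q) dot r ⟩
        (dot * dot + (C - det q a b) * (C - det q a b)) - E * distance² p q
          ≈⟨ +-congʳ (+-congˡ (*-cong difference difference)) ⟩
        (dot * dot + cross * cross) - E * distance² p q
          -- Lagrange's identity: the squares of the dot and cross products of two plane vectors add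
          -- up to the product of the squared lengths.
          ≈⟨ solve 6 (λ e₁ e₂ x y q₁ q₂ →
               let d = e₁ :* (q₁ :- x) :+ e₂ :* (q₂ :- y)
                   c = e₁ :* (q₂ :- y) :- e₂ :* (q₁ :- x)
               in (d :* d :+ c :* c)
                  :- (e₁ :* e₁ :+ e₂ :* e₂) :* ((x :- q₁) :* (x :- q₁) :+ (y :- q₂) :* (y :- q₂))
                  := con (+ 0))
             refl (a₁ - b₁) (a₂ - b₂) x y q₁ q₂ ⟩
        0# ∎

  -- The three strict inequalities persist on a ball around `p`, and any point satisfying them is a
  -- convex combination of the vertices with the normalized determinants as barycentric coordinates.
  triangle⇒Interior-conv : ∀ {A p a b c} → a ∈ₚ A → b ∈ₚ A → c ∈ₚ A →
    0# < det p a b → 0# < det p b c → 0# < det p c a → p ∈ₚ Interior (conv A)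
  triangle⇒Interior-conv {A} {p} {a@(a₁ , a₂)} {b@(b₁ , b₂)} {c@(c₁ , c₂)} a∈A b∈A c∈A ab bc ca =
    interior (forSmall-witness (forSmall-× (det-pos-near p a b ab)
      (forSmall-× (det-pos-near p b c bc) (det-pos-near p c a ca))))
    where
    inside : ∀ q → 0# < det q a b → 0# < det q b c → 0# < det q c a → q ∈ₚ conv A
    -- The scaling factor `s` is the inverse of the sum of the three determinants.
    inside q@(q₁ , q₂) ab bc ca with inverse-pos (+-pos bc (+-pos ca ab))
    ... | s , 0<s , total≈1 =
      3 , a ∷ b ∷ c ∷ [] , det q b c * s ∷ det q c a * s ∷ det q a b * s ∷ [] ,
      (λ { zero → a∈A ; (suc zero) → b∈A ; (suc (suc zero)) → c∈A }) ,
      (λ { zero → inj₁ (*-pos bc 0<s)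
         ; (suc zero) → inj₁ (*-pos ca 0<s)
         ; (suc (suc zero)) → inj₁ (*-pos ab 0<s) }) ,
      trans (solve 4 (λ α β γ s → α :* s :+ (β :* s :+ (γ :* s :+ con (+ 0)))
                               := (α :+ (β :+ γ)) :* s) refl (det q b c) (det q c a) (det q a b) s)
            total≈1 ,
      coordinate q₁ a₁ b₁ c₁ (solve 8 (λ q₁ q₂ a₁ a₂ b₁ b₂ c₁ c₂ →
        det-poly q₁ q₂ b₁ b₂ c₁ c₂ :* (a₁ :- q₁)
          :+ (det-poly q₁ q₂ c₁ c₂ a₁ a₂ :* (b₁ :- q₁) :+ det-poly q₁ q₂ a₁ a₂ b₁ b₂ :* (c₁ :- q₁))
        := con (+ 0)) refl q₁ q₂ a₁ a₂ b₁ b₂ c₁ c₂) ,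
      coordinate q₂ a₂ b₂ c₂ (solve 8 (λ q₁ q₂ a₁ a₂ b₁ b₂ c₁ c₂ →
        det-poly q₁ q₂ b₁ b₂ c₁ c₂ :* (a₂ :- q₂)
          :+ (det-poly q₁ q₂ c₁ c₂ a₁ a₂ :* (b₂ :- q₂) :+ det-poly q₁ q₂ a₁ a₂ b₁ b₂ :* (c₂ :- q₂))
        := con (+ 0)) refl q₁ q₂ a₁ a₂ b₁ b₂ c₁ c₂)
      where
      -- The premise says, in one coordinate, that `q` is the centre of mass of the vertices
      -- weighted by the opposite determinants; multiplying by `s` normalizes the weights.
      coordinate : ∀ z a b c →
        det q (b₁ , b₂) (c₁ , c₂) * (a - z)
          + (det q (c₁ , c₂) (a₁ , a₂) * (b - z) + det q (a₁ , a₂) (b₁ , b₂) * (c - z)) ≈ 0# →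
        z ≈ det q (b₁ , b₂) (c₁ , c₂) * s * a
              + (det q (c₁ , c₂) (a₁ , a₂) * s * b + (det q (a₁ , a₂) (b₁ , b₂) * s * c + 0#))
      coordinate z a b c balanced = begin
        z                                    ≈⟨ +-identityʳ z ⟨
        z + 0#                               ≈⟨ +-cong (trans (*-congʳ total≈1) (*-identityˡ z))
                                                       (trans (*-congˡ balanced) (zeroʳ s)) ⟨
        (α + (β + γ)) * s * z + s * (α * (a - z) + (β * (b - z) + γ * (c - z)))
          ≈⟨ solve 8 (λ α β γ s z a b c →
               (α :+ (β :+ γ)) :* s :* z :+ s :* (α :* (a :- z) :+ (β :* (b :- z) :+ γ :* (c :- z)))
                 := α :* s :* a :+ (β :* s :* b :+ (γ :* s :* c :+ con (+ 0))))
             refl α β γ s z a b c ⟩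
        α * s * a + (β * s * b + (γ * s * c + 0#)) ∎
        where
        α β γ : Carrier
        α = det q (b₁ , b₂) (c₁ , c₂)
        β = det q (c₁ , c₂) (a₁ , a₂)
        γ = det q (a₁ , a₂) (b₁ , b₂)

    interior : ∃[ r ] (0# < r) × (∀ q → q ∈ₚ Ball p r → 0# < det q a b)
                               × (∀ q → q ∈ₚ Ball p r → 0# < det q b c)
                               × (∀ q → q ∈ₚ Ball p r → 0# < det q c a) → p ∈ₚ Interior (conv A)
    interior (r , 0<r , ab , bc , ca) =
      r , 0<r , λ {q} q∈ball → inside q (ab q q∈ball) (bc q q∈ball) (ca q q∈ball)

  -- Perturbation into general position.

  -- The displacements are points of the parabola y = x², no three of which are collinear.
  perturb : ∀ {n} → (Fin n → Point) → Carrier → Fin n → Point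
  perturb f t i = proj₁ (f i) + t * τ , proj₂ (f i) + t * (τ * τ)
    where τ = fromℕ (toℕ i)

  module _ {n} (f : Fin n → Point) where
    private
      τ : Fin n → Carrier
      τ i = fromℕ (toℕ i)

      τ-distinct : ∀ {i j} → i ≢ j → τ i ≉ τ j
      τ-distinct {i} {j} i≢j eq = i≢j (Fin.toℕ-injective (fromℕ-injective (toℕ i) (toℕ j) eq))

      -- The coefficients of `t` and t² in the perturbed determinant: `linear` pairs original
      -- differences with differences of displacements, and `vandermonde` is the determinant of the
      -- displacements alone, factored.
      linear vandermonde : (i j k : Fin n) → Carrier
      linear i j k =
        ((proj₁ (f j) - proj₁ (f i)) * (τ k * τ k - τ i * τ i)
          - (proj₂ (f j) - proj₂ (f i)) * (τ k - τ i))
        + ((τ j - τ i) * (proj₂ (f k) - proj₂ (f i))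
          - (τ j * τ j - τ i * τ i) * (proj₁ (f k) - proj₁ (f i)))
      vandermonde i j k = (τ j - τ i) * ((τ k - τ i) * (τ k - τ j))

      det-perturb : ∀ t i j k → det (f i) (f j) (f k) + t * (linear i j k + t * vandermonde i j k)
                    ≈ det (perturb f t i) (perturb f t j) (perturb f t k)
      det-perturb t i j k =
        solve 10 (λ t xi yi xj yj xk yk a b c →
          det-poly xi yi xj yj xk yk
            :+ t :* ((((xj :- xi) :* (c :* c :- a :* a) :- (yj :- yi) :* (c :- a))
                      :+ ((b :- a) :* (yk :- yi) :- (b :* b :- a :* a) :* (xk :- xi)))
                     :+ t :* ((b :- a) :* ((c :- a) :* (c :- b))))
          := det-poly (xi :+ t :* a) (yi :+ t :* (a :* a)) (xj :+ t :* b) (yj :+ t :* (b :* b))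
                      (xk :+ t :* c) (yk :+ t :* (c :* c)))
          refl t (proj₁ (f i)) (proj₂ (f i)) (proj₁ (f j)) (proj₂ (f j)) (proj₁ (f k)) (proj₂ (f k))
          (τ i) (τ j) (τ k)

    perturb-det-pos : ∀ i j k → 0# < det (f i) (f j) (f k) →
      ForSmall (λ t → 0# < det (perturb f t i) (perturb f t j) (perturb f t k))
    perturb-det-pos i j k 0<det = forSmall-map
      (λ t _ → <-respʳ-≈ (det-perturb t i j k))
      (quadratic-pos (linear i j k) (vandermonde i j k) 0<det)

    perturb-det-≉0 : ∀ i j k → i ≢ j → j ≢ k → i ≢ k →
      ForSmall (λ t → det (perturb f t i) (perturb f t j) (perturb f t k) ≉ 0#)
    perturb-det-≉0 i j k i≢j j≢k i≢k = forSmall-map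
      (λ t _ value≉0 det≈0 → value≉0 (trans (det-perturb t i j k) det≈0))
      (quadratic-≉0 (λ (_ , _ , e≈0) → vandermonde≉0 e≈0))
      where
      vandermonde≉0 : vandermonde i j k ≉ 0#
      vandermonde≉0 = *-≉0 (-‿≉0 (τ-distinct (i≢j ∘ ≡.sym)))
        (*-≉0 (-‿≉0 (τ-distinct (i≢k ∘ ≡.sym))) (-‿≉0 (τ-distinct (j≢k ∘ ≡.sym))))

    -- First coordinates suffice: their difference is a polynomial in `t` whose linear coefficient
    -- is the nonzero `τ i - τ j`.
    perturb-distinct : ∀ i j → i ≢ j → ForSmall (λ t → ¬ (perturb f t i ≋ perturb f t j))
    perturb-distinct i j i≢j = forSmall-map
      (λ t _ value≉0 (x≈ , _) → value≉0 (begin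
        (proj₁ (f i) - proj₁ (f j)) + t * ((τ i - τ j) + t * 0#)
          ≈⟨ solve 5 (λ x y t a b → (x :- y) :+ t :* ((a :- b) :+ t :* con (+ 0))
                                 := (x :+ t :* a) :- (y :+ t :* b))
               refl (proj₁ (f i)) (proj₁ (f j)) t (τ i) (τ j) ⟩
        (proj₁ (f i) + t * τ i) - (proj₁ (f j) + t * τ j)  ≈⟨ +-congʳ x≈ ⟩
        (proj₁ (f j) + t * τ j) - (proj₁ (f j) + t * τ j)  ≈⟨ -‿inverseʳ _ ⟩
        0# ∎))
      (quadratic-≉0 (λ (_ , d≈0 , _) → -‿≉0 (τ-distinct i≢j) d≈0))

  -- Refinement of the orientations.

  NoZeroDet : ∀ {n} → (Fin n → Point) → Set
  NoZeroDet f = ∀ i j k → i ≢ j → j ≢ k → i ≢ k → det (f i) (f j) (f k) ≉ 0#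

  -- Positive signs are enough, since exchanging two indices turns a negative determinant into a
  -- positive one. Zero determinants may acquire either sign.
  Refines : ∀ {n} → (Fin n → Point) → (Fin n → Point) → Set
  Refines g f = ∀ i j k → 0# < det (f i) (f j) (f k) → 0# < det (g i) (g j) (g k)

  -- There are finitely many pairs and triples of indices, so a single small `t` meets all the
  -- conditions.
  general-refinement : ∀ {n} (f : Fin n → Point) →
    ∃[ P ] Refines (point P) f × NoZeroDet (point {n} P)
  general-refinement {n} f = build (forSmall-witness
    (forSmall-× (forSmall-∀ λ i → forSmall-∀ λ j → forSmall-→ (¬? (i Fin.≟ j)) (perturb-distinct f i j))
    (forSmall-× (forSmall-∀ λ i → forSmall-∀ λ j → forSmall-∀ λ k →
                  forSmall-→ (_ <? _) (perturb-det-pos f i j k))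
                (forSmall-∀ λ i → forSmall-∀ λ j → forSmall-∀ λ k →
                  forSmall-→ (¬? (i Fin.≟ j)) λ i≢j →
                  forSmall-→ (¬? (j Fin.≟ k)) λ j≢k →
                  forSmall-→ (¬? (i Fin.≟ k)) (perturb-det-≉0 f i j k i≢j j≢k)))))
    where
    build : ∃[ t ] (0# < t) × (∀ i j → i ≢ j → ¬ (perturb f t i ≋ perturb f t j))
                            × Refines (perturb f t) f × NoZeroDet (perturb f t) →
            ∃[ P ] Refines (point P) f × NoZeroDet (point {n} P)
    build (t , _ , apart , refines , noZero) =
      record { point = perturb f t ; distinct = injective } , refines , noZero
      where
      injective : ∀ {i j} → perturb f t i ≋ perturb f t j → i ≡ j
      injective {i} {j} eq = decidable-stable (i Fin.≟ j) λ i≢j → apart i j i≢j eq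

  noZeroDet⇒generalPosition : ∀ {n} (P : PointSet n) → NoZeroDet (point P) → GeneralPosition P
  noZeroDet⇒generalPosition P noZero i j k i≢j j≢k i≢k collinear =
    noZero i j k i≢j j≢k i≢k (collinear⇒det≈0 collinear)

  0≮det⇒0≤det : ∀ p q r → ¬ (0# < det p q r) → 0# ≤ det p r q
  0≮det⇒0≤det p q r 0≮ = 0≤-cong (sym (det-swap p q r)) (0≮⇒0≤-neg 0≮)

  -- Convex position expressed by orientations.

  -- The source of the tournament around `i` spans with `i` a line that has all of `S` on one side.
  -- The first alternative is that `i` is the only element of `S`.
  convexPosition⇒extreme : ∀ {n} (P : PointSet n) (S : Subset n) → NoZeroDet (point P) →
    ConvexPosition (subsetOf P S) → ∀ i → i ∈ S →
    (∀ j → ¬ (j ∈ S × i ≢ j)) ⊎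
    ∃[ j ] (j ∈ S × i ≢ j) ×
           (∀ k → k ∈ S × i ≢ k → 0# ≤ det (point P i) (point P j) (point P k))
  convexPosition⇒extreme {n} P S noZero convex i i∈S =
    source (λ j k → 0# ≤ det (p i) (p j) (p k)) (λ j → (j ∈? S) ×-dec ¬? (i Fin.≟ j)) total transitive
    where
    p : Fin n → Point
    p = point P

    member : ∀ {j} → j ∈ S → p j ∈ₚ subsetOf P S
    member j∈S = _ , j∈S , refl , refl

    total : ∀ j k → j ∈ S × i ≢ j → k ∈ S × i ≢ k →
            0# ≤ det (p i) (p j) (p k) ⊎ 0# ≤ det (p i) (p k) (p j)
    total j k _ _ with 0# <? det (p i) (p j) (p k)
    ... | yes 0<det = inj₁ (inj₁ 0<det)
    ... | no  0≮det = inj₂ (0≮det⇒0≤det (p i) (p j) (p k) 0≮det)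

    transitive : ∀ j k l → j ∈ S × i ≢ j → k ∈ S × i ≢ k → l ∈ S × i ≢ l →
                 0# ≤ det (p i) (p j) (p k) → 0# ≤ det (p i) (p k) (p l) → 0# ≤ det (p i) (p j) (p l)
    transitive j k l (j∈S , i≢j) (k∈S , i≢k) (l∈S , i≢l) jk kl
      with j Fin.≟ k | k Fin.≟ l | 0# <? det (p i) (p l) (p j)
    ... | yes ≡.refl | _          | _        = kl
    ... | no _       | yes ≡.refl | _        = jk
    ... | no _       | no _       | no 0≮lj  = 0≮det⇒0≤det (p i) (p l) (p j) 0≮lj
    -- A cyclic triple would put `i` strictly inside the triangle `j`, `k`, `l`; `noZero` makes the
    -- two weak inequalities strict.
    ... | no j≢k     | no k≢l     | yes 0<lj = ⊥-elim (proj₂ (convex (member i∈S))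
      (triangle⇒Interior-conv {subsetOf P S} (member j∈S) (member k∈S) (member l∈S)
        (0≤∧≉0⇒0< jk (noZero i j k i≢j j≢k i≢k)) (0≤∧≉0⇒0< kl (noZero i k l i≢k k≢l i≢l)) 0<lj))

  -- The line through `i` and `j` supports `S`, which keeps `i` out of the interior of the hull.
  extreme⇒convexPosition : ∀ {n} (P : PointSet n) (S : Subset n) →
    (∀ i → i ∈ S →
      (∀ j → ¬ (j ∈ S × i ≢ j)) ⊎
      ∃[ j ] (j ∈ S × i ≢ j) ×
             (∀ k → k ∈ S × i ≢ k → 0# ≤ det (point P i) (point P j) (point P k))) →
    ConvexPosition (subsetOf P S)
  extreme⇒convexPosition {n} P S extreme {p} (i , i∈S , p≈ , p≈′) =
    ⊆Closure-conv (i , i∈S , p≈ , p≈′) , supported (extreme i i∈S)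
    where
    supported : _ → p ∉ₚ Interior (conv (subsetOf P S))
    -- Every member of the set coincides with `p`, so the form vanishes on it and any nonzero
    -- direction would do.
    supported (inj₁ alone) = supported⇒∉Interior-conv 1# 0# (λ (1≈0 , _) → 0<⇒≉0 0<1 1≈0) support
      where
      support : ∀ {q} → q ∈ₚ subsetOf P S → 0# ≤ 1# * (proj₁ q - proj₁ p) + 0# * (proj₂ q - proj₂ p)
      support {q} (k , k∈S , q≈ , q≈′) with i Fin.≟ k
      ... | no  i≢k    = ⊥-elim (alone k (k∈S , i≢k))
      ... | yes ≡.refl = inj₂ (begin
        0#  ≈⟨ -‿inverseʳ (proj₁ p) ⟨
        proj₁ p - proj₁ p  ≈⟨ +-congʳ (trans p≈ (sym q≈)) ⟩
        proj₁ q - proj₁ p  ≈⟨ solve 2 (λ a b → a := con (+ 1) :* a :+ con (+ 0) :* b) refl _ _ ⟩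
        1# * (proj₁ q - proj₁ p) + 0# * (proj₂ q - proj₂ p) ∎)
    supported (inj₂ (j , (j∈S , i≢j) , left)) = supported⇒∉Interior-conv u v nonzero support
      where
      a b : Point
      a = point P i
      b = point P j
      u v : Carrier
      -- The vector from `a` to `b` turned by a right angle: its product with c - a is `det a b c`.
      u = - (proj₂ b - proj₂ a)
      v = proj₁ b - proj₁ a
      nonzero : ¬ (u ≈ 0# × v ≈ 0#)
      nonzero (u≈0 , v≈0) = i≢j (≡.sym (distinct P
        ( x∙y⁻¹≈ε⇒x≈y _ _ v≈0
        , x∙y⁻¹≈ε⇒x≈y _ _ (trans (sym (⁻¹-involutive _)) (trans (-‿cong u≈0) ε⁻¹≈ε)))))
        where open AbelianGroupProperties +-abelianGroup
      support : ∀ {q} → q ∈ₚ subsetOf P S → 0# ≤ u * (proj₁ q - proj₁ p) + v * (proj₂ q - proj₂ p)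
      support {q} (k , k∈S , q≈ , q≈′) = 0≤-cong (begin
        det a b c
          ≈⟨ solve 6 (λ x₁ y₁ x₂ y₂ x₃ y₃ → det-poly x₁ y₁ x₂ y₂ x₃ y₃
                 := (:- (y₂ :- y₁)) :* (x₃ :- x₁) :+ (x₂ :- x₁) :* (y₃ :- y₁))
               refl (proj₁ a) (proj₂ a) (proj₁ b) (proj₂ b) (proj₁ c) (proj₂ c) ⟩
        u * (proj₁ c - proj₁ a) + v * (proj₂ c - proj₂ a)
          ≈⟨ +-cong (*-congˡ (+-cong q≈ (-‿cong p≈))) (*-congˡ (+-cong q≈′ (-‿cong p≈′))) ⟨
        u * (proj₁ q - proj₁ p) + v * (proj₂ q - proj₂ p) ∎) 0≤det
        where
        c : Point
        c = point P k
        0≤det : 0# ≤ det a b c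
        0≤det with i Fin.≟ k
        ... | no  i≢k    = left k (k∈S , i≢k)
        ... | yes ≡.refl = inj₂
          (solve 4 (λ x₁ y₁ x₂ y₂ → con (+ 0) := det-poly x₁ y₁ x₂ y₂ x₁ y₁)
            refl (proj₁ a) (proj₂ a) (proj₁ b) (proj₂ b))

  -- The supporting partner `j` found in `P′` also serves in `P`: a triple strictly on the wrong
  -- side in `P` would stay there in `P′`.
  refined-convexPosition : ∀ {n} (P P′ : PointSet n) (S : Subset n) →
    Refines (point P′) (point P) → NoZeroDet (point P′) →
    ConvexPosition (subsetOf P′ S) → ConvexPosition (subsetOf P S)
  refined-convexPosition P P′ S refines noZero convex = extreme⇒convexPosition P S λ i i∈S →
    Sum.map₂ (λ (j , Qj , left) → j , Qj , λ k Qk → weaken i j k (left k Qk))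
      (convexPosition⇒extreme P′ S noZero convex i i∈S)
    where
    weaken : ∀ i j k → 0# ≤ det (point P′ i) (point P′ j) (point P′ k) →
             0# ≤ det (point P i) (point P j) (point P k)
    weaken i j k 0≤det′ = 0≮det⇒0≤det _ _ _ λ 0<det →
      -- By `refines` with `j` and `k` exchanged, the negated determinant of `P′` is positive;
      -- adding the nonnegative determinant itself gives `0# < 0#`.
      irrefl refl (<-respʳ-≈ (-‿inverseʳ _) (<-respʳ-≈ (+-comm _ _) (+-pos-nonneg (
        <-respʳ-≈ (det-swap (point P′ i) (point P′ j) (point P′ k)) (refines i k j 0<det)) 0≤det′)))

open import Data.Nat using (_≤_)

theorem1 : (ℝ : CompleteOrderedField) (k : ℤ) (N : ℕ) → Plane.IsES ℝ k N →
    ∀ {n} (P : Plane.PointSet ℝ n) → N ≤ n → Plane.ContainsConvexPosition ℝ k P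
theorem1 ℝ k N (sufficient , _) P N≤n =
  -- `P′` has the same index set as `P`, so the subset `S` found for `P′` selects equally many
  -- points of `P`.
  let P′ , refines , noZero = general-refinement (Plane.point P)
      S , k≤∣S∣ , convex    = sufficient P′ N≤n (noZeroDet⇒generalPosition P′ noZero)
  in S , k≤∣S∣ , refined-convexPosition P P′ S refines noZero convex
  where open Geometry ℝ
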